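{- Let $q$ be a prime power, let $m,n\ge 1$, and let $\mathcal{C}$ be an $[n,k,d]_{q^m/q}$ code. If $2d>n$, then $\mathcal{C}$ is rank-metric intersecting.
   Context: Support and rank: fix an $\mathbb{F}_q$-basis $\Gamma$ of $\mathbb{F}_{q^m}$. For $x=(x_1,\dots,x_n)\in\mathbb{F}_{q^m}^n$ let $\mathrm{Mat}_\Gamma(x)\in\mathbb{F}_q^{m\times n}$ be the matrix whose $j$-th column is the coordinate vector of $x_j$ in the basis $\Gamma$. The support $\sigma(x)\subseteq\mathbb{F}_q^n$ is the $\mathbb{F}_q$-row space of $\mathrm{Mat}_\Gamma(x)$, and $\mathrm{rk}(x)=\dim_{\mathbb{F}_q}\sigma(x)$; both are independent of $\Gamma$. An $[n,k,d]_{q^m/q}$ code is an $\mathbb{F}_{q^m}$-linear subspace $\mathcal{C}$ of $\mathbb{F}_{q^m}^n$ with $k=\dim_{\mathbb{F}_{q^m}}\mathcal{C}\ge 1$ and minimum distance $d=\min_{c\in\mathcal{C}\setminus\{0\}}\mathrm{rk}(c)$. The code is rank-metric intersecting if $\sigma(c)\cap\sigma(c')\ne\{0\}$ for all $c,c'\in\mathcal{C}\setminus\{0\}$. -}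

module Defs where

open import Algebra.Apartness using (HeytingField; HeytingCommutativeRing)
open import Algebra.Bundles using (CommutativeRing; Ring)
open import Algebra.Module.Bundles using (LeftModule)
open import Algebra.Module.Construct.TensorUnit using () renaming (leftModule to tensorUnit)
open import Algebra.Morphism.Bundles using (RingHomomorphism)
open import Data.Fin.Base using (Fin)
open import Data.Nat.Base using (ℕ; _≤_; _^_)
open import Data.Nat.Primality using (Prime)
open import Data.Product.Base using (∃; ∃₂; _×_; _,_; proj₁; proj₂)
open import Data.Vec.Functional using (Vector)
open import Data.Vec.Functional.Relation.Binary.Equality.Setoid using (≋-isEquivalence)
open import Function.Bundles using (Inverse)
open import Level using (Level; _⊔_)
open import Relation.Binary.Bundles using (Setoid)
open import Relation.Binary.Definitions using (_Respects_)
open import Relation.Binary.PropositionalEquality using (_≡_; setoid)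
open import Relation.Unary using (Pred; _∈_; _∩_; U)

IsPrimePower : ℕ → Set
IsPrimePower q = ∃₂ λ p e → Prime p × 1 ≤ e × q ≡ p ^ e

HasCardinality : ∀ {a ℓ} → Setoid a ℓ → ℕ → Set (a ⊔ ℓ)
HasCardinality S q = Inverse (setoid (Fin q)) S

-- For a field with finitely many elements, invertibility is decidable, so the
-- apartness of a Heyting field is just the negation of _≈_: finite Heyting
-- fields are exactly the usual finite fields.

fieldRing : ∀ {c ℓ ℓ#} → HeytingField c ℓ ℓ# → Ring c ℓ
fieldRing F = CommutativeRing.ring
  (HeytingCommutativeRing.commutativeRing (HeytingField.heytingCommutativeRing F))

-- The n-fold power of a left module, with coordinatewise operations.
power : ∀ {c ℓ a ℓa} {R : Ring c ℓ} → LeftModule R a ℓa → ℕ → LeftModule R a ℓa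
power M n = record
  { Carrierᴹ = Vector M.Carrierᴹ n
  ; _≈ᴹ_ = λ x y → ∀ i → x i M.≈ᴹ y i
  ; _+ᴹ_ = λ x y i → x i M.+ᴹ y i
  ; _*ₗ_ = λ a x i → a M.*ₗ x i
  ; 0ᴹ = λ _ → M.0ᴹ
  ; -ᴹ_ = λ x i → M.-ᴹ x i
  ; isLeftModule = record
    { isLeftSemimodule = record
      { +ᴹ-isCommutativeMonoid = record
        { isMonoid = record
          { isSemigroup = record
            { isMagma = record
              { isEquivalence = ≋-isEquivalence M.≈ᴹ-setoid n
              ; ∙-cong = λ p q i → M.+ᴹ-cong (p i) (q i)
              }
            ; assoc = λ x y z i → M.+ᴹ-assoc (x i) (y i) (z i)
            }
          ; identity = (λ x i → M.+ᴹ-identityˡ (x i)) , (λ x i → M.+ᴹ-identityʳ (x i))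
          }
        ; comm = λ x y i → M.+ᴹ-comm (x i) (y i)
        }
      ; isPreleftSemimodule = record
        { *ₗ-cong = λ p q i → M.*ₗ-cong p (q i)
        ; *ₗ-zeroˡ = λ x i → M.*ₗ-zeroˡ (x i)
        ; *ₗ-distribʳ = λ x a b i → M.*ₗ-distribʳ (x i) a b
        ; *ₗ-identityˡ = λ x i → M.*ₗ-identityˡ (x i)
        ; *ₗ-assoc = λ a b x i → M.*ₗ-assoc a b (x i)
        ; *ₗ-zeroʳ = λ a i → M.*ₗ-zeroʳ a
        ; *ₗ-distribˡ = λ a x y i → M.*ₗ-distribˡ a (x i) (y i)
        }
      }
    ; -ᴹ‿cong = λ p i → M.-ᴹ‿cong (p i)
    ; -ᴹ‿inverse = (λ x i → M.-ᴹ‿inverseˡ (x i)) , (λ x i → M.-ᴹ‿inverseʳ (x i))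
    }
  }
  where module M = LeftModule M

-- S as a left R-module through a ring homomorphism R → S.
restrictScalars : ∀ {c ℓ c′ ℓ′} (R : Ring c ℓ) (S : Ring c′ ℓ′) →
                  RingHomomorphism (Ring.rawRing R) (Ring.rawRing S) →
                  LeftModule R c′ ℓ′
restrictScalars R S ι = record
  { Carrierᴹ = S.Carrier
  ; _≈ᴹ_ = S._≈_
  ; _+ᴹ_ = S._+_
  ; _*ₗ_ = λ a x → ⟦ a ⟧ S.* x
  ; 0ᴹ = S.0#
  ; -ᴹ_ = S.-_
  ; isLeftModule = record
    { isLeftSemimodule = record
      { +ᴹ-isCommutativeMonoid = S.+-isCommutativeMonoid
      ; isPreleftSemimodule = record
        { *ₗ-cong = λ p q → S.*-cong (⟦⟧-cong p) q
        ; *ₗ-zeroˡ = λ x → S.trans (S.*-congʳ 0#-homo) (S.zeroˡ x)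
        ; *ₗ-distribʳ = λ x a b → S.trans (S.*-congʳ (+-homo a b)) (S.distribʳ x ⟦ a ⟧ ⟦ b ⟧)
        ; *ₗ-identityˡ = λ x → S.trans (S.*-congʳ 1#-homo) (S.*-identityˡ x)
        ; *ₗ-assoc = λ a b x → S.trans (S.*-congʳ (*-homo a b)) (S.*-assoc ⟦ a ⟧ ⟦ b ⟧ x)
        ; *ₗ-zeroʳ = λ a → S.zeroʳ ⟦ a ⟧
        ; *ₗ-distribˡ = λ a x y → S.distribˡ ⟦ a ⟧ x y
        }
      }
    ; -ᴹ‿cong = S.-‿cong
    ; -ᴹ‿inverse = S.-‿inverse
    }
  }
  where
  module S = Ring S
  open RingHomomorphism ι

module LinearAlgebra {c ℓ a ℓa : Level} {R : Ring c ℓ} (M : LeftModule R a ℓa) where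
  open Ring R using (Carrier; _≈_; 0#)
  open LeftModule M
  open import Algebra.Properties.Monoid.Sum +ᴹ-monoid using (sum)

  combination : ∀ {n} → Vector Carrier n → Vector Carrierᴹ n → Carrierᴹ
  combination α v = sum (λ i → α i *ₗ v i)

  Span : ∀ {n} → Vector Carrierᴹ n → Pred Carrierᴹ (c ⊔ ℓa)
  Span v x = ∃ λ α → combination α v ≈ᴹ x

  Independent : ∀ {n} → Vector Carrierᴹ n → Set (c ⊔ ℓ ⊔ ℓa)
  Independent v = ∀ α → combination α v ≈ᴹ 0ᴹ → ∀ i → α i ≈ 0#

  record IsSubspace {p} (P : Pred Carrierᴹ p) : Set (c ⊔ a ⊔ ℓa ⊔ p) where
    field
      respects  : P Respects _≈ᴹ_
      0-closed  : 0ᴹ ∈ P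
      +-closed  : ∀ {x y} → x ∈ P → y ∈ P → x +ᴹ y ∈ P
      *ₗ-closed : ∀ α {x} → x ∈ P → α *ₗ x ∈ P

  record IsBasis {p} (P : Pred Carrierᴹ p) {n} (v : Vector Carrierᴹ n)
                 : Set (c ⊔ ℓ ⊔ a ⊔ ℓa ⊔ p) where
    field
      inside      : ∀ i → v i ∈ P
      independent : Independent v
      spanning    : ∀ x → x ∈ P → x ∈ Span v

  HasDimension : ∀ {p} → Pred Carrierᴹ p → ℕ → Set (c ⊔ ℓ ⊔ a ⊔ ℓa ⊔ p)
  HasDimension P k = ∃ λ (v : Vector Carrierᴹ k) → IsBasis P v

-- F and K play the roles of F_q and F_{q^m}, and Γ is an F-basis of K.
module RankMetric
  {c ℓ ℓ# c′ ℓ′ ℓ#′ : Level}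
  (F : HeytingField c ℓ ℓ#) (K : HeytingField c′ ℓ′ ℓ#′)
  (ι : RingHomomorphism (Ring.rawRing (fieldRing F)) (Ring.rawRing (fieldRing K)))
  {m : ℕ} (Γ : Vector (HeytingField.Carrier K) m)
  (Γ-isBasis : LinearAlgebra.IsBasis (restrictScalars (fieldRing F) (fieldRing K) ι) U Γ)
  where

  private
    module F = HeytingField F
    module K = HeytingField K

  F^_ : ℕ → LeftModule (fieldRing F) c ℓ
  F^ n = power tensorUnit n

  K^_ : ℕ → LeftModule (fieldRing K) c′ ℓ′
  K^ n = power tensorUnit n

  module F^ (n : ℕ) where
    open LeftModule (F^ n) public
    open LinearAlgebra (F^ n) public

  module K^ (n : ℕ) where
    open LeftModule (K^ n) public
    open LinearAlgebra (K^ n) public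

  coordinates : K.Carrier → Vector F.Carrier m
  coordinates x = proj₁ (LinearAlgebra.IsBasis.spanning Γ-isBasis x _)

  -- Indexed as a family of m rows of length n.
  Mat : ∀ {n} → Vector K.Carrier n → Vector (Vector F.Carrier n) m
  Mat x i j = coordinates (x j) i

  σ : ∀ {n} → Vector K.Carrier n → Pred (Vector F.Carrier n) (c ⊔ ℓ)
  σ {n} x = F^.Span n (Mat x)

  -- rk(x) = r
  HasRank : ∀ {n} → Vector K.Carrier n → ℕ → Set (c ⊔ ℓ)
  HasRank {n} x r = F^.HasDimension n (σ x) r

  record IsMinimumDistance {n p} (C : Pred (Vector K.Carrier n) p) (d : ℕ)
                           : Set (c ⊔ ℓ ⊔ c′ ⊔ ℓ′ ⊔ p) where
    open K^ n using (_≉ᴹ_; 0ᴹ)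
    field
      attained   : ∃ λ x → x ∈ C × x ≉ᴹ 0ᴹ × HasRank x d
      lowerBound : ∀ x r → x ∈ C → x ≉ᴹ 0ᴹ → HasRank x r → d ≤ r

  record IsCode (n k d : ℕ) {p} (C : Pred (Vector K.Carrier n) p)
                : Set (c ⊔ ℓ ⊔ c′ ⊔ ℓ′ ⊔ p) where
    field
      isSubspace        : K^.IsSubspace n C
      dimension         : K^.HasDimension n C k
      1≤k               : 1 ≤ k
      isMinimumDistance : IsMinimumDistance C d

  -- The zero vector lies in every support, so the intersection differs from
  -- {0} precisely when it contains a nonzero vector.
  IsIntersecting : ∀ {n p} → Pred (Vector K.Carrier n) p → Set (c ⊔ ℓ ⊔ c′ ⊔ ℓ′ ⊔ p)
  IsIntersecting {n} C =
    ∀ x y → x ∈ C → x K^ₙ.≉ᴹ K^ₙ.0ᴹ → y ∈ C → y K^ₙ.≉ᴹ K^ₙ.0ᴹ →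
    ∃ λ v → v ∈ σ x ∩ σ y × v F^ₙ.≉ᴹ F^ₙ.0ᴹ
    where
    module F^ₙ = F^ n
    module K^ₙ = K^ n

{-# OPTIONS --safe #-}

-- Let x and y be nonzero codewords, with supports of dimension r, s ≥ d.  Then
-- r + s ≥ 2d > n, so the map (α, β) ↦ ∑ αᵢ uᵢ + ∑ βⱼ wⱼ attached to bases u, w
-- of the two supports sends q^(r+s) elements to F^n, which has q^n.  A collision
-- of this map gives a nonzero vector in both supports.  Constructively, a basis of
-- a support exists because membership in a span is decided by finite search.
module Submission where

open import Defs
open import Algebra.Apartness using (HeytingField)
open import Algebra.Bundles using (Ring)
open import Algebra.Module.Bundles using (LeftModule)
open import Algebra.Morphism.Bundles using (RingHomomorphism)
open import Data.Fin.Base using (Fin; zero; suc; _↑ˡ_; _↑ʳ_; splitAt; join; combine; funToFin; finToFun)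
open import Data.Fin.Properties
  using (any?; pigeonhole; <⇒≢; join-splitAt; funToFin-finToFin; finToFun-funToFin)
  renaming (_≟_ to _≟ᶠ_)
open import Data.Nat.Base using (ℕ; suc; _+_; _≤_; _<_; _*_; _^_; nonTrivial⇒n>1)
open import Data.Nat.Primality using (prime⇒nonTrivial)
open import Data.Nat.Properties using (^-monoʳ-<; <-≤-trans; +-mono-≤; +-identityʳ; ≤-reflexive; ≤-trans)
open import Data.Product.Base using (∃; ∃₂; _×_; _,_; proj₁)
open import Data.Sum.Base using (_⊎_; inj₁; inj₂)
open import Data.Vec.Functional using (Vector; []; _∷_; tail)
open import Data.Vec.Functional.Relation.Binary.Equality.Setoid using (≋-setoid)
open import Function.Base using (_∘_)
open import Function.Bundles using (Inverse)
open import Level using (Level)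
open import Relation.Binary.Bundles using (Setoid)
import Relation.Binary.Definitions as B
open import Relation.Binary.PropositionalEquality as ≡ using (_≡_)
import Relation.Binary.Reasoning.Setoid as ≈-Reasoning
open import Relation.Nullary using (¬_; Dec; yes; no; contradiction; map′)
open import Relation.Unary using (Pred; U; _∈_; _⊆_; _∩_; Decidable)

private
  variable
    a b c ℓ ℓ₁ ℓ₂ p : Level
    m n : ℕ

-- Finite setoids: enumeration, exhaustive search and collisions.

funToFin-cong : {f g : Fin m → Fin n} → (∀ i → f i ≡ g i) → funToFin f ≡ funToFin g
funToFin-cong {m = ℕ.zero}  f≗g = ≡.refl
funToFin-cong {m = suc m}    f≗g = ≡.cong₂ combine (f≗g zero) (funToFin-cong (f≗g ∘ suc))

↑-elim : (P : Fin (m + n) → Set p) → (∀ i → P (i ↑ˡ n)) → (∀ j → P (m ↑ʳ j)) → ∀ i → P i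
↑-elim {m = m} {n = n} P l r i = ≡.subst P (join-splitAt m n i) (joined (splitAt m i))
  where
  joined : (i : Fin m ⊎ Fin n) → P (join m n i)
  joined (inj₁ i) = l i
  joined (inj₂ j) = r j

primePower>1 : ∀ {q} → IsPrimePower q → 1 < q
primePower>1 (p , e , pr , 1≤e , ≡.refl) =
  -- The bound `1` is `p ^ 0`, and `1≤e` is the same as `0 < e`.
  ^-monoʳ-< p (nonTrivial⇒n>1 p {{prime⇒nonTrivial pr}}) 1≤e

module _ (S : Setoid a ℓ) (|S| : HasCardinality S n) where
  open Setoid S
  open Inverse |S|

  -- `from` has the left inverse `to` up to `_≈_`, hence is injective, and equality can be tested in
  -- `Fin n`.
  ≈-dec : B.Decidable _≈_
  ≈-dec x y = map′ from-injective from-cong (from x ≟ᶠ from y)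
    where
    from-injective : from x ≡ from y → x ≈ y
    from-injective eq = trans (sym (strictlyInverseˡ x)) (trans (to-cong eq) (strictlyInverseˡ y))

  -- Only the listed elements `to i` are searched. Since `P` respects `_≈_`, a witness `x` can be
  -- traded for the listed element `to (from x)`.
  ∃-dec : {P : Pred Carrier p} → P B.Respects _≈_ → Decidable P → Dec (∃ P)
  ∃-dec resp P? = map′
    (λ (i , Pi) → to i , Pi)
    (λ (x , Px) → from x , resp (sym (strictlyInverseˡ x)) Px)
    (any? (P? ∘ to))

  -- Entries are coded one by one in `Fin n`, and the resulting function `Fin m → Fin n` is read as
  -- the digits of a number below `n ^ m`.
  vector-cardinality : ∀ m → HasCardinality (≋-setoid S m) (n ^ m)
  vector-cardinality m = record
    { to        = λ k → to ∘ finToFun {n} {m} k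
    ; from      = λ x → funToFin (from ∘ x)
    ; to-cong   = λ { ≡.refl i → refl }
    ; from-cong = λ x≋y → funToFin-cong (λ i → from-cong (x≋y i))
    ; inverse   =
        (λ { {x} ≡.refl i → trans (to-cong (finToFun-funToFin (from ∘ x) i)) (strictlyInverseˡ (x i)) })
      , (λ {k} x≋ → ≡.trans
          (funToFin-cong (λ i → ≡.trans (from-cong (x≋ i)) (strictlyInverseʳ (finToFun {n} {m} k i))))
          (funToFin-finToFin {m} {n} k))
    }

collision : (S : Setoid a ℓ₁) (T : Setoid b ℓ₂) →
            HasCardinality S m → HasCardinality T n → n < m →
            let module S = Setoid S; module T = Setoid T in
            (f : S.Carrier → T.Carrier) → ∃₂ λ x y → ¬ (x S.≈ y) × f x T.≈ f y
collision S T |S| |T| n<m f with pigeonhole n<m (T.from ∘ f ∘ S.to)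
  where
  module S = Inverse |S|
  module T = Inverse |T|
... | i , j , i<j , eq =
  S.to i , S.to j ,
  -- If the two elements agreed, so would their codes `i` and `j`.
  (λ x≈y → <⇒≢ i<j (≡.trans (≡.sym (S.strictlyInverseʳ i))
                            (≡.trans (S.from-cong x≈y) (S.strictlyInverseʳ j)))) ,
  Setoid.trans T (Setoid.sym T (T.strictlyInverseˡ _))
                 (Setoid.trans T (T.to-cong eq) (T.strictlyInverseˡ _))
  where
  module S = Inverse |S|
  module T = Inverse |T|

-- Apartness from 0 is only known not to be refutable for a nonzero element, so
-- the inverse has to come from a search.
finiteField-inverse : (F : HeytingField c ℓ₁ ℓ₂) → HasCardinality (Ring.setoid (fieldRing F)) n →
                      let module F = HeytingField F in
                      ∀ x → ¬ (x F.≈ F.0#) → ∃ λ y → y F.* x F.≈ F.1#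
finiteField-inverse F |F| x x≉0
  with ∃-dec (Ring.setoid (fieldRing F)) |F|
             (λ y≈z yx≈1 → F.trans (F.*-congʳ (F.sym y≈z)) yx≈1)
             (λ y → ≈-dec (Ring.setoid (fieldRing F)) |F| (y F.* x) F.1#)
  where module F = HeytingField F
... | yes inverse = inverse
... | no ¬inverse = contradiction (proj₁ (F.tight x F.0#) ¬x#0) x≉0
  where
  module F = HeytingField F
  x-0≈x : x F.- F.0# F.≈ x
  x-0≈x = F.trans (F.+-congˡ -0#≈0#) (F.+-identityʳ x)
    where open import Algebra.Properties.Ring (fieldRing F) using (-0#≈0#)
  ¬x#0 : ¬ (x F.# F.0#)
  ¬x#0 x#0 with F.#⇒invertible x#0
  ... | y , y[x-0]≈1 , _ = ¬inverse (y , F.trans (F.*-congˡ (F.sym x-0≈x)) y[x-0]≈1)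

-- Linear combinations and spans over a ring.

module Spans {R : Ring c ℓ} (M : LeftModule R a ℓ₁) where
  private module R = Ring R
  open LeftModule M
  open LinearAlgebra M
  open import Algebra.Properties.Group +ᴹ-group using () renaming (∙-cancelʳ to +ᴹ-cancelʳ)
  open import Algebra.Properties.Group R.+-group using () renaming (x∙y⁻¹≈ε⇒x≈y to x-y≈0⇒x≈y)
  open import Algebra.Properties.Monoid.Sum +ᴹ-monoid using (sum-cong-≋; sum-replicate-zero)
  open import Algebra.Properties.CommutativeMonoid.Sum +ᴹ-commutativeMonoid using (∑-distrib-+)
  open ≈-Reasoning ≈ᴹ-setoid

  combination-cong : ∀ {α β : Vector R.Carrier n} v → (∀ i → α i R.≈ β i) →
                     combination α v ≈ᴹ combination β v
  combination-cong v α≈β = sum-cong-≋ (λ i → *ₗ-congʳ (α≈β i))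

  combination-0 : ∀ (v : Vector Carrierᴹ n) → combination (λ _ → R.0#) v ≈ᴹ 0ᴹ
  combination-0 {n} v = ≈ᴹ-trans (sum-cong-≋ (λ i → *ₗ-zeroˡ (v i))) (sum-replicate-zero n)

  combination-+ : ∀ α β (v : Vector Carrierᴹ n) →
                  combination (λ i → α i R.+ β i) v ≈ᴹ combination α v +ᴹ combination β v
  combination-+ α β v = ≈ᴹ-trans
    (sum-cong-≋ (λ i → *ₗ-distribʳ (v i) (α i) (β i)))
    (∑-distrib-+ (λ i → α i *ₗ v i) (λ i → β i *ₗ v i))

  combination-* : ∀ s α (v : Vector Carrierᴹ n) →
                  combination (λ i → s R.* α i) v ≈ᴹ s *ₗ combination α v
  combination-* {ℕ.zero} s α v = ≈ᴹ-sym (*ₗ-zeroʳ s)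
  combination-* {suc n}  s α v = ≈ᴹ-trans
    (+ᴹ-cong (*ₗ-assoc s _ _) (combination-* s (tail α) (tail v)))
    (≈ᴹ-sym (*ₗ-distribˡ s _ _))

  -- Stated additively, so that differences are handled by right cancellation and never by rules for
  -- negated combinations.
  combination-difference : ∀ α β (v : Vector Carrierᴹ n) →
    combination (λ i → α i R.- β i) v +ᴹ combination β v ≈ᴹ combination α v
  combination-difference α β v = ≈ᴹ-trans
    (≈ᴹ-sym (combination-+ (λ i → α i R.- β i) β v))
    (combination-cong v (λ i → R.trans (R.+-assoc _ _ _)
      (R.trans (R.+-congˡ (R.-‿inverseˡ _)) (R.+-identityʳ _))))

  Span-resp : (v : Vector Carrierᴹ n) → Span v B.Respects _≈ᴹ_
  Span-resp v x≈y (α , eq) = α , ≈ᴹ-trans eq x≈y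

  Span-+ : ∀ {x y} (v : Vector Carrierᴹ n) → x ∈ Span v → y ∈ Span v → x +ᴹ y ∈ Span v
  Span-+ v (α , p) (β , q) = _ , ≈ᴹ-trans (combination-+ α β v) (+ᴹ-cong p q)

  Span-* : ∀ s {x} (v : Vector Carrierᴹ n) → x ∈ Span v → s *ₗ x ∈ Span v
  Span-* s v (α , p) = _ , ≈ᴹ-trans (combination-* s α v) (*ₗ-congˡ p)

  Span-⊆ : ∀ {r} (v : Vector Carrierᴹ n) {w : Vector Carrierᴹ r} →
           (∀ i → w i ∈ Span v) → Span w ⊆ Span v
  Span-⊆ {r = ℕ.zero} v w⊆ (α , 0≈x) = _ , ≈ᴹ-trans (combination-0 v) 0≈x
  Span-⊆ {r = suc r}  v w⊆ (α , eq)  = Span-resp v eq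
    (Span-+ v (Span-* (α zero) v (w⊆ zero)) (Span-⊆ v (w⊆ ∘ suc) (tail α , ≈ᴹ-refl)))

  Span-tail : (v : Vector Carrierᴹ (suc n)) → Span (tail v) ⊆ Span v
  Span-tail v {x} (α , p) = (R.0# ∷ α) , (begin
    R.0# *ₗ v zero +ᴹ combination α (tail v) ≈⟨ +ᴹ-cong (*ₗ-zeroˡ _) p ⟩
    0ᴹ +ᴹ x                                  ≈⟨ +ᴹ-identityˡ x ⟩
    x                                        ∎)

  Span-head : (v : Vector Carrierᴹ (suc n)) → v zero ∈ Span v
  Span-head v = (R.1# ∷ λ _ → R.0#) , (begin
    R.1# *ₗ v zero +ᴹ combination (λ _ → R.0#) (tail v) ≈⟨ +ᴹ-cong (*ₗ-identityˡ _) (combination-0 (tail v)) ⟩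
    v zero +ᴹ 0ᴹ                                        ≈⟨ +ᴹ-identityʳ _ ⟩
    v zero                                              ∎)

  -- Bases of finitely generated spans when nonzero scalars are invertible.

  module _ (_≈0? : Decidable (R._≈ R.0#))
           (inverse : ∀ s → ¬ (s R.≈ R.0#) → ∃ λ t → t R.* s R.≈ R.1#) where

    -- A nonzero coefficient of `x` in a relation could be divided out, placing `x` in `Span v`. So
    -- that coefficient vanishes, and what remains is a relation among `v` alone.
    ∷-independent : ∀ {x} {v : Vector Carrierᴹ n} → Independent v → ¬ (x ∈ Span v) → Independent (x ∷ v)
    ∷-independent {x = x} {v} ind x∉ α eq with α zero ≈0?
    ... | no α₀≉0 with inverse (α zero) α₀≉0
    ...   | t , tα₀≈1 = contradiction (Span-resp v t[α₀x]≈x (Span-* t v (_ , -rest≈α₀x))) x∉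
      where
      rest : Carrierᴹ
      rest = combination (tail α) v
      -- The negative of `rest` has coefficients `0 - αᵢ`, which makes it a member of `Span v` by
      -- form and an instance of `combination-difference`.
      -rest≈α₀x : combination (λ i → R.0# R.- tail α i) v ≈ᴹ α zero *ₗ x
      -rest≈α₀x = +ᴹ-cancelʳ rest _ _ (begin
        combination (λ i → R.0# R.- tail α i) v +ᴹ rest ≈⟨ combination-difference (λ _ → R.0#) (tail α) v ⟩
        combination (λ _ → R.0#) v                      ≈⟨ combination-0 v ⟩
        0ᴹ                                              ≈⟨ eq ⟨
        α zero *ₗ x +ᴹ rest                             ∎)
      t[α₀x]≈x : t *ₗ (α zero *ₗ x) ≈ᴹ x
      t[α₀x]≈x = begin
        t *ₗ (α zero *ₗ x)    ≈⟨ *ₗ-assoc t (α zero) x ⟨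
        (t R.* α zero) *ₗ x   ≈⟨ *ₗ-congʳ tα₀≈1 ⟩
        R.1# *ₗ x             ≈⟨ *ₗ-identityˡ x ⟩
        x                     ∎
    ∷-independent {x = x} {v} ind x∉ α eq | yes α₀≈0 = λ
      { zero    → α₀≈0
      ; (suc i) → ind (tail α) rest≈0 i
      }
      where
      rest≈0 : combination (tail α) v ≈ᴹ 0ᴹ
      rest≈0 = begin
        combination (tail α) v                    ≈⟨ +ᴹ-identityˡ _ ⟨
        0ᴹ +ᴹ combination (tail α) v              ≈⟨ +ᴹ-congʳ (*ₗ-zeroˡ x) ⟨
        R.0# *ₗ x +ᴹ combination (tail α) v       ≈⟨ +ᴹ-congʳ (*ₗ-congʳ α₀≈0) ⟨
        α zero *ₗ x +ᴹ combination (tail α) v     ≈⟨ eq ⟩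
        0ᴹ                                        ∎

    module _ (span? : ∀ {n} (v : Vector Carrierᴹ n) → Decidable (Span v)) where

      -- Greedy selection from the end of the family: the head joins the basis found for the tail
      -- exactly when it is not already in the span of that basis.
      Span-hasDimension : (v : Vector Carrierᴹ n) → ∃ (HasDimension (Span v))
      Span-hasDimension {ℕ.zero} v = 0 , [] , record
        { inside      = λ ()
        ; independent = λ _ _ ()
        -- Every empty combination is `0ᴹ`, so the given equation serves unchanged.
        ; spanning    = λ x (_ , 0≈x) → (λ ()) , 0≈x
        }
      Span-hasDimension {suc n} v with Span-hasDimension (tail v)
      ... | r , w , basis with span? w (v zero)
      ...   | yes v₀∈ = r , w , record
        { inside      = Span-tail v ∘ inside
        ; independent = independent
        ; spanning    = λ x (α , eq) → Span-resp w eq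
            (Span-+ w (Span-* (α zero) w v₀∈) (spanning _ (tail α , ≈ᴹ-refl)))
        }
        where open IsBasis basis
      ...   | no v₀∉ = suc r , v zero ∷ w , record
        { inside      = λ { zero → Span-head v ; (suc i) → Span-tail v (inside i) }
        ; independent = ∷-independent independent v₀∉
        ; spanning    = λ x (α , eq) →
            let β , eq′ = spanning _ (tail α , ≈ᴹ-refl)
            in (α zero ∷ β) , ≈ᴹ-trans (+ᴹ-congˡ eq′) eq
        }
        where open IsBasis basis

  -- Counting in a finite module.

  module _ {q n} (|R| : HasCardinality R.setoid q) (|M| : HasCardinality ≈ᴹ-setoid (q ^ n))
           (1<q : 1 < q) where

    -- In a collision, moving the `u` terms to one side and the `w` terms to the other gives a
    -- single vector written in both families. Cardinality takes the place of a dimension formula: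
    -- `n < r + s` becomes `q ^ n < q ^ (r + s)`.
    spans-meet : ∀ {r s} {u : Vector Carrierᴹ r} {w : Vector Carrierᴹ s} →
                 Independent u → Independent w → n < r + s →
                 ∃ λ v → v ∈ Span u ∩ Span w × v ≉ᴹ 0ᴹ
    spans-meet {r} {s} {u} {w} u-ind w-ind n<r+s
      with collision (≋-setoid R.setoid (r + s)) ≈ᴹ-setoid
                     (vector-cardinality R.setoid |R| (r + s)) |M| (^-monoʳ-< q 1<q n<r+s)
                     -- One vector `γ` of length `r + s` holds both coefficient families as its two
                     -- blocks, so the domain has `q ^ (r + s)` elements.
                     (λ γ → combination (γ ∘ (_↑ˡ s)) u +ᴹ combination (γ ∘ (r ↑ʳ_)) w)
    ... | γ , γ′ , γ≉γ′ , eq = v , ((_ , ≈ᴹ-refl) , (_ , ≈ᴹ-sym v≈v′)) , v≉0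
      where
      α α′ : Vector R.Carrier r
      α  = γ ∘ (_↑ˡ s)
      α′ = γ′ ∘ (_↑ˡ s)
      β β′ : Vector R.Carrier s
      β  = γ ∘ (r ↑ʳ_)
      β′ = γ′ ∘ (r ↑ʳ_)
      v v′ : Carrierᴹ
      v  = combination (λ i → α i R.- α′ i) u
      -- The difference is reversed relative to `v` because the `w` terms cross the equation.
      v′ = combination (λ j → β′ j R.- β j) w
      v≈v′ : v ≈ᴹ v′
      -- Adding `combination α′ u +ᴹ combination β w` to both sides absorbs both differences and
      -- leaves the collision `eq`.
      v≈v′ = +ᴹ-cancelʳ (combination α′ u +ᴹ combination β w) _ _ (begin
        v +ᴹ (combination α′ u +ᴹ combination β w)  ≈⟨ +ᴹ-assoc _ _ _ ⟨
        (v +ᴹ combination α′ u) +ᴹ combination β w  ≈⟨ +ᴹ-congʳ (combination-difference α α′ u) ⟩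
        combination α u +ᴹ combination β w          ≈⟨ eq ⟩
        combination α′ u +ᴹ combination β′ w        ≈⟨ +ᴹ-congˡ (combination-difference β′ β w) ⟨
        combination α′ u +ᴹ (v′ +ᴹ combination β w) ≈⟨ +ᴹ-assoc _ _ _ ⟨
        (combination α′ u +ᴹ v′) +ᴹ combination β w ≈⟨ +ᴹ-congʳ (+ᴹ-comm _ _) ⟩
        (v′ +ᴹ combination α′ u) +ᴹ combination β w ≈⟨ +ᴹ-assoc _ _ _ ⟩
        v′ +ᴹ (combination α′ u +ᴹ combination β w) ∎)
      v≉0 : v ≉ᴹ 0ᴹ
      -- If `v` vanished, so would `v′`; independence of `u` and of `w` would then make `γ` and `γ′`
      -- agree on both blocks.
      v≉0 v≈0 = γ≉γ′ (↑-elim (λ i → γ i R.≈ γ′ i)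
        (λ i → x-y≈0⇒x≈y _ _ (u-ind _ v≈0 i))
        (λ j → R.sym (x-y≈0⇒x≈y _ _ (w-ind _ (≈ᴹ-trans (≈ᴹ-sym v≈v′) v≈0) j))))

theorem2p5 : ∀ {c ℓ ℓ# c′ ℓ′ ℓ#′ p : Level} (q m n k d : ℕ) →
    IsPrimePower q → 1 ≤ m → 1 ≤ n →
    (F : HeytingField c ℓ ℓ#) → HasCardinality (Ring.setoid (fieldRing F)) q →
    (K : HeytingField c′ ℓ′ ℓ#′) → HasCardinality (Ring.setoid (fieldRing K)) (q ^ m) →
    (ι : RingHomomorphism (Ring.rawRing (fieldRing F)) (Ring.rawRing (fieldRing K)))
    (Γ : Vector (HeytingField.Carrier K) m)
    (Γ-isBasis : LinearAlgebra.IsBasis (restrictScalars (fieldRing F) (fieldRing K) ι) U Γ)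
    (C : Pred (Vector (HeytingField.Carrier K) n) p) →
    RankMetric.IsCode F K ι Γ Γ-isBasis n k d C →
    n < 2 * d →
    RankMetric.IsIntersecting F K ι Γ Γ-isBasis C
theorem2p5 {c} {ℓ} q m n k d q-pp _ _ F |F| K _ ι Γ Γ-isBasis C code n<2d x y x∈C x≉0 y∈C y≉0 =
  -- Rank is a relation, not a function, so `lowerBound` applies only once a basis of each support
  -- has been produced.
  let r , u , u-basis = support-hasRank x
      s , w , w-basis = support-hasRank y
      2d≤r+s = +-mono-≤ (lowerBound x r x∈C x≉0 (u , u-basis))
                        -- `2 * d` unfolds to `d + (d + 0)`, hence the correction in the second
                        -- summand.
                        (≤-trans (≤-reflexive (+-identityʳ d)) (lowerBound y s y∈C y≉0 (w , w-basis)))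
      v , (v∈u , v∈w) , v≉0 =
        spans-meet |F| |F^n| (primePower>1 q-pp)
          (independent u-basis) (independent w-basis) (<-≤-trans n<2d 2d≤r+s)
  -- The common vector lies in the spans of the bases; since the basis vectors belong to the
  -- supports, it is rewritten in the rows of each matrix.
  in v , (Span-⊆ (Mat x) (inside u-basis) v∈u , Span-⊆ (Mat y) (inside w-basis) v∈w) , v≉0
  where
  open RankMetric F K ι Γ Γ-isBasis
  open IsMinimumDistance (IsCode.isMinimumDistance code)
  open Spans (F^ n)
  open LinearAlgebra.IsBasis

  |F^n| : HasCardinality (LeftModule.≈ᴹ-setoid (F^ n)) (q ^ n)
  |F^n| = vector-cardinality (Ring.setoid (fieldRing F)) |F| n

  -- There are `q ^ r` coefficient vectors to try, and each resulting equation in `F^ n` is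
  -- decidable.
  span? : ∀ {r} (v : Vector (LeftModule.Carrierᴹ (F^ n)) r) → Decidable (F^.Span n v)
  span? {r} v x = ∃-dec (≋-setoid (Ring.setoid (fieldRing F)) r)
    (vector-cardinality (Ring.setoid (fieldRing F)) |F| r)
    (λ α≈β eq → LeftModule.≈ᴹ-trans (F^ n)
      (LeftModule.≈ᴹ-sym (F^ n) (combination-cong v α≈β)) eq)
    (λ α → ≈-dec (LeftModule.≈ᴹ-setoid (F^ n)) |F^n| (F^.combination n α v) x)

  support-hasRank : ∀ x → ∃ (HasRank x)
  support-hasRank x = Span-hasDimension
    (λ a → ≈-dec (Ring.setoid (fieldRing F)) |F| a (HeytingField.0# F))
    (finiteField-inverse F |F|) span? (Mat x)
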